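{- Let $n\ge 1$, let $\pi\in\mathcal{S}_n$ be a permutation, and let $(P,Q)$ be the pair of standard Young tableaux (insertion tableau $P$, recording tableau $Q$) associated with $\pi$ by the Robinson-Schensted-Knuth correspondence. Then $$\mathrm{sign}(\pi)=\mathrm{sign}(P)\cdot\mathrm{sign}(Q)\cdot(-1)^e,$$ where $e$ is the total length of all even-indexed rows of $P$ (that is, $e=\lambda_2+\lambda_4+\cdots$ if $P$ has shape $\lambda=(\lambda_1,\lambda_2,\ldots)$).
   Context: A standard Young tableau (tableau for short) of shape $\lambda\vdash n$ is a filling of the Young diagram of $\lambda$ (English convention: rows indexed $1,2,\ldots$ from top to bottom, row $i$ having $\lambda_i$ squares, left-justified) with the numbers $1,\ldots,n$, each used once, such that rows increase from left to right and columns increase from top to bottom. The Robinson-Schensted-Knuth correspondence is the bijection between $\mathcal{S}_n$ and pairs $(P,Q)$ of tableaux of the same shape $\lambda\vdash n$: $P$ (the insertion tableau) is obtained by successively row-inserting $\pi_1,\pi_2,\ldots,\pi_n$ (the one-line notation of $\pi$) into the empty tableau, and $Q$ (the recording tableau) has entry $i$ in the square added to the shape at the $i$th insertion. For a tableau $T$, a pair $(i,j)$ of entries is an inversion of $T$ if $j<i$ and $j$ is contained in a row strictly below the row of $i$. Let $\mathrm{inv}(T)$ be the number of inversions of $T$, and $\mathrm{sign}(T)=(-1)^{\mathrm{inv}(T)}$. For a permutation $\pi$, $\mathrm{sign}(\pi)$ is its usual sign. -}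

module Defs where

open import Data.Fin.Base using (toℕ)
open import Data.Fin.Permutation using (Permutation′; _⟨$⟩ʳ_)
open import Data.Fin.Properties using () renaming (_<?_ to _<ᶠ?_)
open import Data.Integer.Base using (ℤ; -1ℤ; _^_)
open import Data.List.Base
  using (List; []; _∷_; [_]; _∷ʳ_; allFin; cartesianProduct; concat; filter; foldl; length; map; tabulate)
open import Data.Maybe.Base using (Maybe; just; nothing)
open import Data.Nat.Base using (ℕ; zero; suc; _+_)
open import Data.Nat.ListAction using (sum)
open import Data.Nat.Properties using (_<?_)
open import Data.Product.Base using (_×_; _,_)
open import Relation.Nullary.Decidable using (yes; no; _×-dec_)

-- A filling of a diagram, as the list of its rows from top to bottom, each
-- row read from left to right.  Standardness is not part of the type: the
-- fillings produced by RSK below are standard as a theorem.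
Filling : Set
Filling = List (List ℕ)

-- The leftmost entry greater than x is replaced by x and returned; if there
-- is none, x is appended at the end of the row.
insertRow : ℕ → List ℕ → List ℕ × Maybe ℕ
insertRow x []       = [ x ] , nothing
insertRow x (y ∷ ys) with x <? y
... | yes _ = x ∷ ys , just y
... | no  _ with insertRow x ys
...   | ys′ , bumped = y ∷ ys′ , bumped

-- Row insertion; the second component is the index, counted from 0, of the
-- row at whose end the shape gains a square.
insert : ℕ → Filling → Filling × ℕ
insert x []       = [ [ x ] ] , 0
insert x (r ∷ rs) with insertRow x r
... | r′ , nothing = r′ ∷ rs , 0
... | r′ , just y  with insert y rs
...   | rs′ , k = r′ ∷ rs′ , suc k

-- Adds a square with entry i at the end of row k, counted from 0, where k may
-- also be the first empty row.  (Larger k do not occur in RSK.)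
addSquare : ℕ → ℕ → Filling → Filling
addSquare _       i []       = [ [ i ] ]
addSquare zero    i (r ∷ rs) = (r ∷ʳ i) ∷ rs
addSquare (suc k) i (r ∷ rs) = r ∷ addSquare k i rs

insertAndRecord : Filling × Filling → ℕ × ℕ → Filling × Filling
insertAndRecord (P , Q) (x , i) with insert x P
... | P′ , k = P′ , addSquare k i Q

-- Fin n is {0, …, n-1}, so both values and positions are shifted by one to
-- obtain entries 1, …, n.
RSK : ∀ {n} → Permutation′ n → Filling × Filling
RSK π = foldl insertAndRecord ([] , [])
  (tabulate (λ i → suc (toℕ (π ⟨$⟩ʳ i)) , suc (toℕ i)))

-- The number of pairs (i , j) with i in is, j in js and j < i.
inversionsBetween : List ℕ → List ℕ → ℕ
inversionsBetween is js =
  length (filter (λ (i , j) → j <? i) (cartesianProduct is js))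

inv : Filling → ℕ
inv []       = 0
inv (r ∷ rs) = inversionsBetween r (concat rs) + inv rs

sign : Filling → ℤ
sign T = -1ℤ ^ inv T

-- The number of pairs (i , j) of positions with i < j and π j < π i.
permInv : ∀ {n} → Permutation′ n → ℕ
permInv {n} π =
  length (filter (λ (i , j) → (i <ᶠ? j) ×-dec ((π ⟨$⟩ʳ j) <ᶠ? (π ⟨$⟩ʳ i)))
                 (cartesianProduct (allFin n) (allFin n)))

permSign : ∀ {n} → Permutation′ n → ℤ
permSign π = -1ℤ ^ permInv π

-- The second, fourth, … rows; the top row has index 1.
evenRows : Filling → Filling
evenRows []           = []
evenRows (_ ∷ [])     = []
evenRows (_ ∷ r ∷ rs) = r ∷ evenRows rs

evenRowsLength : Filling → ℕ
evenRowsLength T = sum (map length (evenRows T))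

{-# OPTIONS --safe #-}

-- Insert the letters one at a time.  If inserting x adds a square in row k, then the
-- inversions of the word grow by the number of entries of P greater than x, and those of
-- Q by the number of squares strictly below row k, because the new entry of Q is the
-- largest.  It remains to compare with the change of inv P and of the even rows, by
-- induction on the rows: when x bumps y out of the top row, y is then inserted below it,
-- and exchanging x for y in the top row changes its inversions with the set C of entries
-- below by an amount determined by how many entries of C exceed x and how many exceed y.
module Submission where

open import Defs
open import Data.Bool.Base using (true; false)
open import Data.Fin.Base as Fin using (Fin; toℕ)
open import Data.Fin.Permutation using (Permutation′; _⟨$⟩ʳ_)
open import Data.Fin.Properties using (toℕ-injective) renaming (_<?_ to _<ᶠ?_)
open import Data.Integer.Base using (ℤ; -1ℤ; _*_; _^_)
open import Data.Integer.Properties using (*-assoc; *-identityˡ; ^-distribˡ-+-*)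
open import Data.List.Base
  using (List; []; _∷_; [_]; _++_; _∷ʳ_; allFin; cartesianProduct; concat; drop; filter;
         foldl; length; map; tabulate)
open import Data.List.Properties
  using (cartesianProductWith-distribʳ-++; filter-++; filter-≐; filter-all; filter-none;
         length-++; map-cong; ++-identityʳ; map-tabulate)
open import Data.List.Relation.Binary.Permutation.Propositional
  using (_↭_; prep; swap; ↭-refl; ↭-sym; ↭-trans; ↭⇒↭ₛ)
open import Data.List.Relation.Binary.Permutation.Propositional.Properties
  using (All-resp-↭; filter-↭; map⁺; shift; ++⁺ˡ; ++⁺ʳ; ↭-length; ∷↭∷ʳ)
import Data.List.Relation.Binary.Permutation.Setoid.Properties as Permutationₛ
open import Data.List.Relation.Unary.All as All using (All; []; _∷_)
import Data.List.Relation.Unary.All.Properties as Allₚ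
open import Data.List.Relation.Unary.AllPairs using (AllPairs; []; _∷_)
import Data.List.Relation.Unary.AllPairs.Properties as AllPairsₚ
open import Data.List.Relation.Unary.Unique.Propositional using (Unique)
import Data.List.Relation.Unary.Unique.Propositional.Properties as Uniqueₚ
open import Data.Maybe.Base using (Maybe; just; nothing)
open import Data.Nat.Base as ℕ using (ℕ; zero; suc; _+_; _≤_; _<_; _≥_; parity; s<s; z<s)
open import Data.Nat.ListAction using (sum)
open import Data.Nat.ListAction.Properties using (sum-↭)
open import Data.Nat.Properties
  using (_<?_; <⇒≤; <-trans; +-assoc; +-cancelˡ-≡; +-comm; ≤∧≢⇒<; ≤⇒≯; ≮⇒≥; suc-injective)
open import Data.Nat.Solver using (module +-*-Solver)
import Data.Parity.Base as ℙ
import Data.Parity.Properties as ℙₚ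
open import Data.Product.Base using (_×_; _,_; proj₁; proj₂)
open import Function.Base using (_∘_; id)
open import Function.Bundles using (Injection)
open import Function.Properties.Inverse using (↔⇒↣)
open import Level using (0ℓ)
open import Relation.Binary.PropositionalEquality
  using (_≡_; _≢_; refl; sym; trans; cong; cong₂; subst; setoid; module ≡-Reasoning)
open import Relation.Nullary.Decidable using (yes; no; does; _×-dec_)
open import Relation.Unary using (Pred; Decidable)

open ≡-Reasoning
open +-*-Solver using (solve; con; _:+_; _:=_)

private
  variable
    A B : Set

-- Inversions between two lists

length-filter-map : {P : Pred B 0ℓ} (P? : Decidable P) (f : A → B) (xs : List A) →
                    length (filter P? (map f xs)) ≡ length (filter (P? ∘ f) xs)
length-filter-map P? f []       = refl
length-filter-map P? f (x ∷ xs) with does (P? (f x))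
... | false = length-filter-map P? f xs
... | true  = cong suc (length-filter-map P? f xs)

length-filter-cartesianProduct :
  {P : Pred (A × B) 0ℓ} (P? : Decidable P) (xs : List A) (ys : List B) →
  length (filter P? (cartesianProduct xs ys)) ≡
  sum (map (λ x → length (filter (λ y → P? (x , y)) ys)) xs)
length-filter-cartesianProduct P? []       ys = refl
length-filter-cartesianProduct P? (x ∷ xs) ys = begin
  length (filter P? (map (x ,_) ys ++ cartesianProduct xs ys))
    ≡⟨ cong length (filter-++ P? (map (x ,_) ys) _) ⟩
  length (filter P? (map (x ,_) ys) ++ filter P? (cartesianProduct xs ys))
    ≡⟨ length-++ (filter P? (map (x ,_) ys)) ⟩
  length (filter P? (map (x ,_) ys)) + length (filter P? (cartesianProduct xs ys))
    ≡⟨ cong₂ _+_ (length-filter-map P? (x ,_) ys) (length-filter-cartesianProduct P? xs ys) ⟩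
  _ ∎

length-concat : (xss : List (List A)) → length (concat xss) ≡ sum (map length xss)
length-concat []         = refl
length-concat (xs ∷ xss) = trans (length-++ xs) (cong (length xs +_) (length-concat xss))

countBelow : ℕ → List ℕ → ℕ
countBelow x ys = length (filter (_<? x) ys)

inversionsBetween-sum : ∀ xs ys →
                        inversionsBetween xs ys ≡ sum (map (λ x → countBelow x ys) xs)
inversionsBetween-sum = length-filter-cartesianProduct _

-- Together with its counterpart on the right, this lets later steps know a row or a filling only up
-- to `↭`, without tracking where insertion places each entry.
inversionsBetween-↭ˡ : ∀ {xs xs′} ys → xs ↭ xs′ →
                       inversionsBetween xs ys ≡ inversionsBetween xs′ ys
inversionsBetween-↭ˡ {xs} {xs′} ys xs↭xs′ = begin
  inversionsBetween xs ys                ≡⟨ inversionsBetween-sum xs ys ⟩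
  sum (map (λ x → countBelow x ys) xs)   ≡⟨ sum-↭ (map⁺ _ xs↭xs′) ⟩
  sum (map (λ x → countBelow x ys) xs′)  ≡⟨ inversionsBetween-sum xs′ ys ⟨
  inversionsBetween xs′ ys               ∎

inversionsBetween-↭ʳ : ∀ xs {ys ys′} → ys ↭ ys′ →
                       inversionsBetween xs ys ≡ inversionsBetween xs ys′
inversionsBetween-↭ʳ xs {ys} {ys′} ys↭ys′ = begin
  inversionsBetween xs ys                ≡⟨ inversionsBetween-sum xs ys ⟩
  sum (map (λ x → countBelow x ys) xs)
    ≡⟨ cong sum (map-cong (λ x → ↭-length (filter-↭ (_<? x) ys↭ys′)) xs) ⟩
  sum (map (λ x → countBelow x ys′) xs)  ≡⟨ inversionsBetween-sum xs ys′ ⟨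
  inversionsBetween xs ys′               ∎

inversionsBetween-++ˡ : ∀ xs xs′ ys → inversionsBetween (xs ++ xs′) ys ≡
                        inversionsBetween xs ys + inversionsBetween xs′ ys
inversionsBetween-++ˡ xs xs′ ys = begin
  inversionsBetween (xs ++ xs′) ys
    ≡⟨ cong (length ∘ filter _) (cartesianProductWith-distribʳ-++ _,_ xs xs′ ys) ⟩
  length (filter _ (cartesianProduct xs ys ++ cartesianProduct xs′ ys))
    ≡⟨ cong length (filter-++ _ (cartesianProduct xs ys) _) ⟩
  _ ≡⟨ length-++ (filter _ (cartesianProduct xs ys)) ⟩
  inversionsBetween xs ys + inversionsBetween xs′ ys ∎

inversionsBetween-[-]ˡ : ∀ x ys → inversionsBetween [ x ] ys ≡ countBelow x ys
inversionsBetween-[-]ˡ x ys = trans (inversionsBetween-sum [ x ] ys) (+-comm _ 0)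

inversionsBetween-∷ˡ : ∀ x xs ys →
                       inversionsBetween (x ∷ xs) ys ≡ countBelow x ys + inversionsBetween xs ys
inversionsBetween-∷ˡ x xs ys = trans (inversionsBetween-++ˡ [ x ] xs ys)
  (cong (_+ inversionsBetween xs ys) (inversionsBetween-[-]ˡ x ys))

inversionsBetween-++ʳ : ∀ xs ys ys′ → inversionsBetween xs (ys ++ ys′) ≡
                        inversionsBetween xs ys + inversionsBetween xs ys′
inversionsBetween-++ʳ []       ys ys′ = refl
inversionsBetween-++ʳ (x ∷ xs) ys ys′ = begin
  inversionsBetween (x ∷ xs) (ys ++ ys′)
    ≡⟨ inversionsBetween-∷ˡ x xs (ys ++ ys′) ⟩
  countBelow x (ys ++ ys′) + inversionsBetween xs (ys ++ ys′)
    ≡⟨ cong₂ _+_ countBelow-++ (inversionsBetween-++ʳ xs ys ys′) ⟩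
  (countBelow x ys + countBelow x ys′) + (inversionsBetween xs ys + inversionsBetween xs ys′)
    ≡⟨ solve 4 (λ a b c d → (a :+ b) :+ (c :+ d) := (a :+ c) :+ (b :+ d)) refl
         (countBelow x ys) _ _ _ ⟩
  (countBelow x ys + inversionsBetween xs ys) + (countBelow x ys′ + inversionsBetween xs ys′)
    ≡⟨ cong₂ _+_ (inversionsBetween-∷ˡ x xs ys) (inversionsBetween-∷ˡ x xs ys′) ⟨
  inversionsBetween (x ∷ xs) ys + inversionsBetween (x ∷ xs) ys′ ∎
  where
  countBelow-++ : countBelow x (ys ++ ys′) ≡ countBelow x ys + countBelow x ys′
  countBelow-++ = trans (cong length (filter-++ (_<? x) ys ys′)) (length-++ (filter (_<? x) ys))

inversionsBetween-none : ∀ {xs ys} → All (λ x → All (x ≤_) ys) xs → inversionsBetween xs ys ≡ 0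
inversionsBetween-none []                         = refl
inversionsBetween-none {x ∷ xs} {ys} (x≤ys ∷ xs≤ys) = begin
  inversionsBetween (x ∷ xs) ys              ≡⟨ inversionsBetween-∷ˡ x xs ys ⟩
  countBelow x ys + inversionsBetween xs ys
    ≡⟨ cong₂ _+_ (cong length (filter-none (_<? x) (All.map ≤⇒≯ x≤ys)))
                 (inversionsBetween-none xs≤ys) ⟩
  0                                          ∎

inversionsBetween-all : ∀ {xs ys} → All (λ x → All (_< x) ys) xs →
                        inversionsBetween xs ys ≡ length xs ℕ.* length ys
inversionsBetween-all []                         = refl
inversionsBetween-all {x ∷ xs} {ys} (ys<x ∷ ys<xs) = trans (inversionsBetween-∷ˡ x xs ys)
  (cong₂ _+_ (cong length (filter-all (_<? x) ys<x)) (inversionsBetween-all ys<xs))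

-- Each entry of `ys` is either smaller or larger than `x`, so exactly one of the two terms counts
-- it.
inversionsBetween-complement : ∀ {x} ys → All (x ≢_) ys →
  inversionsBetween [ x ] ys + inversionsBetween ys [ x ] ≡ length ys
inversionsBetween-complement         []       []             = refl
inversionsBetween-complement {x} (y ∷ ys) (x≢y ∷ x≢ys) = begin
  inversionsBetween [ x ] (y ∷ ys) + inversionsBetween (y ∷ ys) [ x ]
    ≡⟨ cong₂ _+_ (inversionsBetween-++ʳ [ x ] [ y ] ys) (inversionsBetween-++ˡ [ y ] ys [ x ]) ⟩
  (inversionsBetween [ x ] [ y ] + inversionsBetween [ x ] ys) +
  (inversionsBetween [ y ] [ x ] + inversionsBetween ys [ x ])
    ≡⟨ solve 4 (λ a b c d → (a :+ b) :+ (c :+ d) := (a :+ c) :+ (b :+ d)) refl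
         (inversionsBetween [ x ] [ y ]) _ _ _ ⟩
  (inversionsBetween [ x ] [ y ] + inversionsBetween [ y ] [ x ]) +
  (inversionsBetween [ x ] ys + inversionsBetween ys [ x ])
    ≡⟨ cong₂ _+_ one (inversionsBetween-complement ys x≢ys) ⟩
  suc (length ys) ∎
  where
  one : inversionsBetween [ x ] [ y ] + inversionsBetween [ y ] [ x ] ≡ 1
  one with x <? y
  ... | yes x<y = cong₂ _+_ (inversionsBetween-none ((<⇒≤ x<y ∷ []) ∷ []))
                            (inversionsBetween-all ((x<y ∷ []) ∷ []))
  ... | no  x≮y = cong₂ _+_ (inversionsBetween-all ((y<x ∷ []) ∷ []))
                            (inversionsBetween-none ((<⇒≤ y<x ∷ []) ∷ []))
    where
    y<x : y < x
    y<x = ≤∧≢⇒< (≮⇒≥ x≮y) (x≢y ∘ sym)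

-- Terms are moved across so that no subtraction occurs.
inversionsBetween-exchange : ∀ {x y r r′} zs → All (x ≢_) zs → All (y ≢_) zs → x ∷ r ↭ y ∷ r′ →
  inversionsBetween r zs + inversionsBetween zs [ y ] ≡
  inversionsBetween r′ zs + inversionsBetween zs [ x ]
inversionsBetween-exchange {x} {y} {r} {r′} zs x≢zs y≢zs p = +-cancelˡ-≡ (a + c) _ _ (begin
  (a + c) + (R + d)  ≡⟨ solve 4 (λ a c R d → (a :+ c) :+ (R :+ d) := (a :+ R) :+ (c :+ d)) refl
                          a c R d ⟩
  -- `c + d` and `a + b` both equal the length of `zs`, while `a + R` and `c + R′` count the
  -- inversions of the same entries with `zs`.
  (a + R) + (c + d)  ≡⟨ cong₂ _+_ exchanged (trans (inversionsBetween-complement zs y≢zs)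
                                                   (sym (inversionsBetween-complement zs x≢zs))) ⟩
  (c + R′) + (a + b) ≡⟨ solve 4 (λ c R′ a b → (c :+ R′) :+ (a :+ b) := (a :+ c) :+ (R′ :+ b)) refl
                          c R′ a b ⟩
  (a + c) + (R′ + b) ∎)
  where
  a = inversionsBetween [ x ] zs
  b = inversionsBetween zs [ x ]
  c = inversionsBetween [ y ] zs
  d = inversionsBetween zs [ y ]
  R = inversionsBetween r zs
  R′ = inversionsBetween r′ zs
  exchanged : a + R ≡ c + R′
  exchanged = begin
    a + R                          ≡⟨ inversionsBetween-++ˡ [ x ] r zs ⟨
    inversionsBetween (x ∷ r) zs   ≡⟨ inversionsBetween-↭ˡ zs p ⟩
    inversionsBetween (y ∷ r′) zs  ≡⟨ inversionsBetween-++ˡ [ y ] r′ zs ⟩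
    c + R′                         ∎

-- Parity and signs

-- Stands in for subtraction: a term needed on the other side is added twice, and one that has come
-- to occur twice is dropped.
parity-+-double : ∀ m n → parity (m + (n + n)) ≡ parity m
parity-+-double m n = begin
  parity (m + (n + n))                    ≡⟨ ℙₚ.+-homo-+ m (n + n) ⟩
  parity m ℙ.+ parity (n + n)             ≡⟨ cong (parity m ℙ.+_) (ℙₚ.+-homo-+ n n) ⟩
  parity m ℙ.+ (parity n ℙ.+ parity n)    ≡⟨ cong (parity m ℙ.+_) (ℙₚ.p+p≡0ℙ (parity n)) ⟩
  parity m ℙ.+ ℙ.0ℙ                       ≡⟨ ℙₚ.+-identityʳ (parity m) ⟩
  parity m                                ∎

parity-+-congˡ : ∀ k {m n} → parity m ≡ parity n → parity (k + m) ≡ parity (k + n)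
parity-+-congˡ k {m} {n} eq = begin
  parity (k + m)         ≡⟨ ℙₚ.+-homo-+ k m ⟩
  parity k ℙ.+ parity m  ≡⟨ cong (parity k ℙ.+_) eq ⟩
  parity k ℙ.+ parity n  ≡⟨ ℙₚ.+-homo-+ k n ⟨
  parity (k + n)         ∎

-- The passage from counting to signs: the inversion counts are compared in `ℕ` up to parity.
-- Factors -1 cancel in pairs.
-1^-parity : ∀ m n → parity m ≡ parity n → -1ℤ ^ m ≡ -1ℤ ^ n
-1^-parity m n eq = trans (toParity m) (trans (cong signOf eq) (sym (toParity n)))
  where
  signOf : ℙ.Parity → ℤ
  signOf ℙ.0ℙ = -1ℤ ^ 0
  signOf ℙ.1ℙ = -1ℤ ^ 1
  toParity : ∀ k → -1ℤ ^ k ≡ signOf (parity k)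
  toParity zero          = refl
  toParity (suc zero)    = refl
  toParity (suc (suc k)) = begin
    -1ℤ * (-1ℤ * -1ℤ ^ k)  ≡⟨ *-assoc -1ℤ -1ℤ (-1ℤ ^ k) ⟨
    (-1ℤ * -1ℤ) * -1ℤ ^ k  ≡⟨ *-identityˡ (-1ℤ ^ k) ⟩
    -1ℤ ^ k                ≡⟨ toParity k ⟩
    signOf (parity k)      ∎

-- Shapes and even rows

-- Follows `addSquare` clause by clause on row lengths, so that the shapes of both tableaux can be
-- seen to grow in the same way. As there, any index met at the end of the list opens a new row.
growRow : ℕ → List ℕ → List ℕ
growRow _       []       = [ 1 ]
growRow zero    (l ∷ ls) = suc l ∷ ls
growRow (suc k) (l ∷ ls) = l ∷ growRow k ls

-- Row indices start at 0, so dropping `suc k` rows leaves those strictly below row `k`. It is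
-- applied to the shape before the growth; the new square lies in row `k` and would not be counted
-- anyway.
squaresBelow : ℕ → List ℕ → ℕ
squaresBelow k ls = sum (drop (suc k) ls)

length-∷ʳ : ∀ (xs : List A) x → length (xs ∷ʳ x) ≡ suc (length xs)
length-∷ʳ xs x = sym (↭-length (∷↭∷ʳ x xs))

evenRowsLength-head : ∀ r r′ rs → evenRowsLength (r ∷ rs) ≡ evenRowsLength (r′ ∷ rs)
evenRowsLength-head r r′ []      = refl
evenRowsLength-head r r′ (_ ∷ _) = refl

-- Removing the top row turns odd-indexed rows into even-indexed ones and conversely, so the two
-- terms together account for every row below `r` exactly once.
evenRowsLength-∷ : ∀ r rs → evenRowsLength (r ∷ rs) + evenRowsLength rs ≡ length (concat rs)
evenRowsLength-∷ r []        = refl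
evenRowsLength-∷ r (r₁ ∷ rs) = begin
  (length r₁ + evenRowsLength rs) + evenRowsLength (r₁ ∷ rs)
    ≡⟨ +-assoc (length r₁) _ _ ⟩
  length r₁ + (evenRowsLength rs + evenRowsLength (r₁ ∷ rs))
    ≡⟨ cong (length r₁ +_) (trans (+-comm (evenRowsLength rs) _) (evenRowsLength-∷ r₁ rs)) ⟩
  length r₁ + length (concat rs)
    ≡⟨ length-++ r₁ ⟨
  length (r₁ ++ concat rs) ∎

-- Row insertion

Increasing : List ℕ → Set
Increasing = AllPairs _<_

-- The last condition of `bumped` compares the entries of `r` above `x` with those of `r′` above
-- `y`: the former are `y` and everything to its right, the latter only what is to the right of `y`.
data RowInsertion (x : ℕ) (r : List ℕ) : List ℕ × Maybe ℕ → Set where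
  appended : All (_< x) r → RowInsertion x r (r ∷ʳ x , nothing)
  bumped   : ∀ {r′ y} → x ∷ r ↭ y ∷ r′ → Increasing r′ →
             inversionsBetween r [ x ] ≡ suc (inversionsBetween r′ [ y ]) →
             RowInsertion x r (r′ , just y)

insertRow-correct : ∀ x r → Increasing r → All (x ≢_) r → RowInsertion x r (insertRow x r)
insertRow-correct x []       _             _            = appended []
insertRow-correct x (y ∷ ys) (y<ys ∷ ys<) (x≢y ∷ x≢ys) with x <? y
... | yes x<y = bumped (swap x y ↭-refl) (x<ys ∷ ys<) (begin
  inversionsBetween (y ∷ ys) [ x ]
    ≡⟨ inversionsBetween-all (All.map (_∷ []) (x<y ∷ x<ys)) ⟩
  suc (length ys ℕ.* 1)
    ≡⟨ cong suc (inversionsBetween-all (All.map (_∷ []) y<ys)) ⟨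
  suc (inversionsBetween ys [ y ])
    ≡⟨ cong (λ n → suc (n + inversionsBetween ys [ y ]))
            (inversionsBetween-none ((<⇒≤ x<y ∷ []) ∷ [])) ⟨
  suc (inversionsBetween [ x ] [ y ] + inversionsBetween ys [ y ])
    ≡⟨ cong suc (inversionsBetween-++ˡ [ x ] ys [ y ]) ⟨
  suc (inversionsBetween (x ∷ ys) [ y ]) ∎)
  where
  x<ys : All (x <_) ys
  x<ys = All.map (<-trans x<y) y<ys
... | no x≮y with insertRow x ys | insertRow-correct x ys ys< x≢ys
...   | _ , nothing | appended ys<x = appended (y<x ∷ ys<x)
  where
  y<x : y < x
  y<x = ≤∧≢⇒< (≮⇒≥ x≮y) (x≢y ∘ sym)
-- `y` is below `x` and below all of `ys`, hence also below the rearrangement `z ∷ ys′`. So it keeps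
-- the new row increasing and adds nothing to either count.
...   | ys′ , just z | bumped p ys′< eq with All-resp-↭ p (≤∧≢⇒< (≮⇒≥ x≮y) (x≢y ∘ sym) ∷ y<ys)
...     | y<z ∷ y<ys′ = bumped
  (↭-trans (swap x y ↭-refl) (↭-trans (prep y p) (swap y z ↭-refl)))
  (y<ys′ ∷ ys′<)
  (begin
    inversionsBetween (y ∷ ys) [ x ]
      ≡⟨ inversionsBetween-++ˡ [ y ] ys [ x ] ⟩
    inversionsBetween [ y ] [ x ] + inversionsBetween ys [ x ]
      ≡⟨ cong₂ _+_ (inversionsBetween-none ((≮⇒≥ x≮y ∷ []) ∷ [])) eq ⟩
    suc (inversionsBetween ys′ [ z ])
      ≡⟨ cong (λ n → suc (n + inversionsBetween ys′ [ z ]))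
              (inversionsBetween-none ((<⇒≤ y<z ∷ []) ∷ [])) ⟨
    suc (inversionsBetween [ y ] [ z ] + inversionsBetween ys′ [ z ])
      ≡⟨ cong suc (inversionsBetween-++ˡ [ y ] ys′ [ z ]) ⟨
    suc (inversionsBetween (y ∷ ys′) [ z ]) ∎)

-- Insertion into a filling

Unique-resp-↭ : ∀ {xs ys : List A} → xs ↭ ys → Unique xs → Unique ys
Unique-resp-↭ {A} p = Permutationₛ.Unique-resp-↭ (setoid A) (↭⇒↭ₛ p)

Unique-++⁻ʳ : ∀ (xs : List A) {ys} → Unique (xs ++ ys) → Unique ys
Unique-++⁻ʳ []       u       = u
Unique-++⁻ʳ (x ∷ xs) (_ ∷ u) = Unique-++⁻ʳ xs u

-- `inversions` is the balance of one insertion. The entries of `P` above `x` are the inversions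
-- that the word gains, and `squaresBelow` is what `inv Q` will gain. Since `Q` enters only through
-- the shape, the induction on rows can be carried out on `P` alone.
record Insertion (x : ℕ) (P P′ : Filling) (k : ℕ) : Set where
  field
    entries    : concat P′ ↭ x ∷ concat P
    increasing : All Increasing P′
    shape      : map length P′ ≡ growRow k (map length P)
    inversions : parity (inversionsBetween (concat P) [ x ] + (inv P + evenRowsLength P)) ≡
                 parity ((inv P′ + evenRowsLength P′) + squaresBelow k (map length P))

-- In the bumping case the parities of the even rows of the whole filling and of the rows below
-- differ by the number of entries below. That number grows by 1 when `y` arrives, and this makes up
-- for the 1 lost when the entries above `x` in `r` become the entries above `y` in `r′`.
insert-correct : ∀ x P → All Increasing P → Unique (x ∷ concat P) →
                 Insertion x P (proj₁ (insert x P)) (proj₂ (insert x P))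
insert-correct x [] _ _ = record
  { entries    = ↭-refl
  ; increasing = ([] ∷ []) ∷ []
  ; shape      = refl
  ; inversions = refl
  }
insert-correct x (r ∷ rs) (r< ∷ rs<) u@(x∉ ∷ _)
  with insertRow x r | insertRow-correct x r r< (Allₚ.++⁻ˡ r x∉)
... | _ , nothing | appended r<x = record
  { entries    = ++⁺ʳ (concat rs) (↭-sym (∷↭∷ʳ x r))
  ; increasing = AllPairsₚ.++⁺ r< ([] ∷ []) (All.map (_∷ []) r<x) ∷ rs<
  ; shape      = cong (_∷ map length rs) (length-∷ʳ r x)
  ; inversions = begin
      parity (inversionsBetween (r ++ C) [ x ] + (R + inv rs + evenRowsLength (r ∷ rs)))
        ≡⟨ cong (λ n → parity (n + (R + inv rs + evenRowsLength (r ∷ rs)))) above ⟩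
      parity (c + (R + inv rs + evenRowsLength (r ∷ rs)))
        -- One `b` is the number of inversions that `x` brings to the top row; the other completes
        -- `c` to the number of squares below.
        ≡⟨ parity-+-double (c + (R + inv rs + evenRowsLength (r ∷ rs))) b ⟨
      parity (c + (R + inv rs + evenRowsLength (r ∷ rs)) + (b + b))
        ≡⟨ cong parity (solve 5 (λ c R I e b → c :+ (R :+ I :+ e) :+ (b :+ b) :=
                                               R :+ b :+ I :+ e :+ (b :+ c)) refl
                          c R (inv rs) (evenRowsLength (r ∷ rs)) b) ⟩
      parity (R + b + inv rs + evenRowsLength (r ∷ rs) + (b + c))
        ≡⟨ cong parity (cong₂ _+_
             (cong₂ (λ m n → m + inv rs + n) (inversionsBetween-++ˡ r [ x ] C)
                                             (evenRowsLength-head (r ∷ʳ x) r rs))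
             (sym (trans (inversionsBetween-complement C (Allₚ.++⁻ʳ r x∉)) (length-concat rs)))) ⟨
      parity (inversionsBetween (r ∷ʳ x) C + inv rs + evenRowsLength ((r ∷ʳ x) ∷ rs) +
              sum (map length rs)) ∎
  }
  where
  C = concat rs
  R = inversionsBetween r C
  b = inversionsBetween [ x ] C
  c = inversionsBetween C [ x ]
  above : inversionsBetween (r ++ C) [ x ] ≡ c
  above = trans (inversionsBetween-++ˡ r C [ x ])
    (cong (_+ c) (inversionsBetween-none (All.map ((_∷ []) ∘ <⇒≤) r<x)))
... | r′ , just y | bumped p r′< eq
  -- Bumping only rearranges the entries, so `r′ ++ y ∷ concat rs` has no repetition either. Its
  -- part after `r′` is what inserting `y` below requires, and it supplies `y∉` for the exchange.
  with u′ ← Unique-resp-↭ (↭-trans (++⁺ʳ (concat rs) p) (↭-sym (shift y r′ (concat rs)))) u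
  with u″@(y∉ ∷ _) ← Unique-++⁻ʳ r′ u′
  with insert y rs | insert-correct y rs rs< u″
...   | rs′ , k | I = record
  { entries    = ↭-trans (++⁺ˡ r′ I.entries)
                   (↭-trans (shift y r′ C) (++⁺ʳ C (↭-sym p)))
  ; increasing = r′< ∷ I.increasing
  ; shape      = cong₂ _∷_ (suc-injective (sym (↭-length p))) I.shape
  ; inversions = begin
      parity (inversionsBetween (r ++ C) [ x ] + (R + inv rs + e))
        ≡⟨ cong (λ n → parity (n + (R + inv rs + e)))
             (trans (inversionsBetween-++ˡ r C [ x ]) (cong (_+ cx) eq)) ⟩
      parity (suc a + cx + (R + inv rs + e))
        -- One copy of `E + cy` completes the left side of the induction hypothesis; in the other,
        -- `cy` joins `R` for the exchange and `E` joins `e` to give all rows below.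
        ≡⟨ parity-+-double (suc a + cx + (R + inv rs + e)) (E + cy) ⟨
      parity (suc a + cx + (R + inv rs + e) + ((E + cy) + (E + cy)))
        ≡⟨ cong parity (solve 7 (λ a cx R I e E cy →
             con 1 :+ a :+ cx :+ (R :+ I :+ e) :+ ((E :+ cy) :+ (E :+ cy)) :=
             con 1 :+ a :+ cx :+ (cy :+ (I :+ E)) :+ ((R :+ cy) :+ (e :+ E))) refl
             a cx R (inv rs) e E cy) ⟩
      parity (suc a + cx + (cy + (inv rs + E)) + ((R + cy) + (e + E)))
        ≡⟨ cong (λ n → parity (suc a + cx + (cy + (inv rs + E)) + n)) (cong₂ _+_
             (inversionsBetween-exchange C (Allₚ.++⁻ʳ r x∉) y∉ p) (evenRowsLength-∷ r rs)) ⟩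
      parity (suc a + cx + (cy + (inv rs + E)) + ((R′ + cx) + N))
        ≡⟨ cong parity (solve 5 (λ a cx J R′ N →
             con 1 :+ a :+ cx :+ J :+ ((R′ :+ cx) :+ N) :=
             con 1 :+ a :+ R′ :+ N :+ J :+ (cx :+ cx)) refl a cx (cy + (inv rs + E)) R′ N) ⟩
      parity (suc a + R′ + N + (cy + (inv rs + E)) + (cx + cx))
        -- One `cx` came from the inversions of the word, the other from the exchange; they cancel,
        -- leaving the rows below compared with `y` only.
        ≡⟨ parity-+-double (suc a + R′ + N + (cy + (inv rs + E))) cx ⟩
      parity (suc a + R′ + N + (cy + (inv rs + E)))
        ≡⟨ parity-+-congˡ (suc a + R′ + N) I.inversions ⟩
      parity (suc a + R′ + N + ((inv rs′ + E′) + K))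
        -- The 1 from bumping is joined to `N`: `suc N` is the number of entries below the top row
        -- once `y` has been inserted there.
        ≡⟨ cong parity (solve 6 (λ a R′ N I E K →
             con 1 :+ a :+ R′ :+ N :+ ((I :+ E) :+ K) :=
             ((a :+ R′) :+ I :+ K) :+ (con 1 :+ N) :+ E) refl a R′ N (inv rs′) E′ K) ⟩
      parity (a + R′ + inv rs′ + K + suc N + E′)
        ≡⟨ cong (λ n → parity (a + R′ + inv rs′ + K + n + E′))
             (trans (evenRowsLength-∷ r′ rs′) (↭-length I.entries)) ⟨
      parity (a + R′ + inv rs′ + K + (e′ + E′) + E′)
        ≡⟨ cong parity (solve 6 (λ a R′ I K e E →
             ((a :+ R′) :+ I :+ K) :+ (e :+ E) :+ E :=
             (a :+ R′) :+ I :+ e :+ K :+ (E :+ E)) refl a R′ (inv rs′) K e′ E′) ⟩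
      parity (a + R′ + inv rs′ + e′ + K + (E′ + E′))
        ≡⟨ parity-+-double (a + R′ + inv rs′ + e′ + K) E′ ⟩
      parity (a + R′ + inv rs′ + e′ + K)
        ≡⟨ cong (λ n → parity (n + inv rs′ + e′ + K))
             (trans (inversionsBetween-↭ʳ r′ I.entries) (inversionsBetween-++ʳ r′ [ y ] C)) ⟨
      parity (inversionsBetween r′ (concat rs′) + inv rs′ + e′ + K) ∎
  }
  where
  module I = Insertion I
  C  = concat rs
  N  = length C
  K  = squaresBelow k (map length rs)
  R  = inversionsBetween r C
  R′ = inversionsBetween r′ C
  a  = inversionsBetween r′ [ y ]
  cx = inversionsBetween C [ x ]
  cy = inversionsBetween C [ y ]
  e  = evenRowsLength (r ∷ rs)
  e′ = evenRowsLength (r′ ∷ rs′)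
  E  = evenRowsLength rs
  E′ = evenRowsLength rs′

-- The recording tableau

addSquare-entries : ∀ k i Q → concat (addSquare k i Q) ↭ i ∷ concat Q
addSquare-entries zero    i []       = ↭-refl
addSquare-entries (suc k) i []       = ↭-refl
addSquare-entries zero    i (r ∷ rs) = ++⁺ʳ (concat rs) (↭-sym (∷↭∷ʳ i r))
addSquare-entries (suc k) i (r ∷ rs) =
  ↭-trans (++⁺ˡ r (addSquare-entries k i rs)) (shift i r (concat rs))

addSquare-shape : ∀ k i Q → map length (addSquare k i Q) ≡ growRow k (map length Q)
addSquare-shape zero    i []       = refl
addSquare-shape (suc k) i []       = refl
addSquare-shape zero    i (r ∷ rs) = cong (_∷ map length rs) (length-∷ʳ r i)
addSquare-shape (suc k) i (r ∷ rs) = cong (length r ∷_) (addSquare-shape k i rs)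

-- As the larger entry, `i` forms an inversion with every square below its row; it is never the
-- smaller entry, so the rows above gain nothing.
inv-addSquare : ∀ k i Q → All (_< i) (concat Q) →
                inv (addSquare k i Q) ≡ inv Q + squaresBelow k (map length Q)
inv-addSquare zero    i []       _   = refl
inv-addSquare (suc k) i []       _   = refl
inv-addSquare zero    i (r ∷ rs) <i = begin
  inversionsBetween (r ∷ʳ i) C + inv rs
    ≡⟨ cong (_+ inv rs) (inversionsBetween-++ˡ r [ i ] C) ⟩
  inversionsBetween r C + inversionsBetween [ i ] C + inv rs
    ≡⟨ cong (λ n → inversionsBetween r C + n + inv rs)
            (inversionsBetween-all (Allₚ.++⁻ʳ r <i ∷ [])) ⟩
  inversionsBetween r C + (length C + 0) + inv rs
    ≡⟨ cong (λ n → inversionsBetween r C + (n + 0) + inv rs) (length-concat rs) ⟩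
  inversionsBetween r C + (sum (map length rs) + 0) + inv rs
    ≡⟨ solve 3 (λ R S I → R :+ (S :+ con 0) :+ I := R :+ I :+ S) refl
         (inversionsBetween r C) (sum (map length rs)) (inv rs) ⟩
  inversionsBetween r C + inv rs + sum (map length rs) ∎
  where C = concat rs
inv-addSquare (suc k) i (r ∷ rs) <i = begin
  inversionsBetween r (concat (addSquare k i rs)) + inv (addSquare k i rs)
    ≡⟨ cong₂ _+_ top (inv-addSquare k i rs (Allₚ.++⁻ʳ r <i)) ⟩
  inversionsBetween r C + (inv rs + squaresBelow k (map length rs))
    ≡⟨ +-assoc (inversionsBetween r C) _ _ ⟨
  inversionsBetween r C + inv rs + squaresBelow k (map length rs) ∎
  where
  C = concat rs
  top : inversionsBetween r (concat (addSquare k i rs)) ≡ inversionsBetween r C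
  top = begin
    inversionsBetween r (concat (addSquare k i rs))
      ≡⟨ inversionsBetween-↭ʳ r (addSquare-entries k i rs) ⟩
    inversionsBetween r (i ∷ C)
      ≡⟨ inversionsBetween-++ʳ r [ i ] C ⟩
    inversionsBetween r [ i ] + inversionsBetween r C
      ≡⟨ cong (_+ inversionsBetween r C)
              (inversionsBetween-none (All.map ((_∷ []) ∘ <⇒≤) (Allₚ.++⁻ˡ r <i))) ⟩
    inversionsBetween r C ∎

-- The correspondence

wordInversions : List ℕ → ℕ
wordInversions []       = 0
wordInversions (x ∷ xs) = inversionsBetween [ x ] xs + wordInversions xs

-- The exponent of -1 on the right-hand side of the sign formula.
defect : Filling × Filling → ℕ
defect (P , Q) = inv P + evenRowsLength P + inv Q

-- Generalised to an arbitrary intermediate pair for the induction on the remaining word. The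
-- letters already inserted all precede the remaining ones, so their order among themselves no
-- longer matters and `concat P` can stand for them.
foldl-insertAndRecord : ∀ P Q ps →
  All Increasing P → map length P ≡ map length Q →
  Unique (map proj₁ ps ++ concat P) →
  Increasing (map proj₂ ps) → All (λ i → All (_< i) (concat Q)) (map proj₂ ps) →
  parity (defect (foldl insertAndRecord (P , Q) ps)) ≡
  parity (defect (P , Q) +
          (inversionsBetween (concat P) (map proj₁ ps) + wordInversions (map proj₁ ps)))
foldl-insertAndRecord P Q [] _ _ _ _ _ =
  cong parity (sym (trans (cong (λ n → defect (P , Q) + (n + 0))
    (inversionsBetween-none (All.universal (λ _ → []) (concat P)))) (+-comm (defect (P , Q)) 0)))
foldl-insertAndRecord P Q ((x , i) ∷ ps) P< shape≡ u (i< ∷ is<) (Q<i ∷ Q<is) = begin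
  parity (defect (foldl insertAndRecord (P′ , Q′) ps))
    ≡⟨ foldl-insertAndRecord P′ Q′ ps I.increasing shape′ u′ is< Q′<is ⟩
  parity (inv P′ + evenRowsLength P′ + inv Q′ + (inversionsBetween (concat P′) xs + w))
    -- Equality of the shapes turns the growth of `inv Q` into the same `K` that the insertion into
    -- `P` produces.
    ≡⟨ cong₂ (λ m n → parity (inv P′ + evenRowsLength P′ + m + (n + w)))
         (trans (inv-addSquare k i Q Q<i) (cong (λ ls → inv Q + squaresBelow k ls) (sym shape≡)))
         (trans (inversionsBetween-↭ˡ xs I.entries) (inversionsBetween-++ˡ [ x ] (concat P) xs)) ⟩
  parity (inv P′ + evenRowsLength P′ + (inv Q + K) + (b + d + w))
    ≡⟨ cong parity (solve 6 (λ T q K b d w →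
         T :+ (q :+ K) :+ (b :+ d :+ w) := (q :+ b :+ d :+ w) :+ (T :+ K)) refl
         (inv P′ + evenRowsLength P′) (inv Q) K b d w) ⟩
  parity (inv Q + b + d + w + (inv P′ + evenRowsLength P′ + K))
    ≡⟨ parity-+-congˡ (inv Q + b + d + w) I.inversions ⟨
  parity (inv Q + b + d + w + (c + (inv P + evenRowsLength P)))
    ≡⟨ cong parity (solve 6 (λ T q c b d w →
         (q :+ b :+ d :+ w) :+ (c :+ T) := T :+ q :+ (c :+ d :+ (b :+ w))) refl
         (inv P + evenRowsLength P) (inv Q) c b d w) ⟩
  parity (defect (P , Q) + (c + d + (b + w)))
    ≡⟨ cong (λ n → parity (defect (P , Q) + (n + (b + w))))
         (inversionsBetween-++ʳ (concat P) [ x ] xs) ⟨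
  parity (defect (P , Q) + (inversionsBetween (concat P) (x ∷ xs) + (b + w))) ∎
  where
  P′ = proj₁ (insert x P)
  k  = proj₂ (insert x P)
  Q′ = addSquare k i Q
  xs = map proj₁ ps
  w  = wordInversions xs
  K  = squaresBelow k (map length P)
  b  = inversionsBetween [ x ] xs
  c  = inversionsBetween (concat P) [ x ]
  d  = inversionsBetween (concat P) xs
  -- With `x` moved next to `concat P`, the part after `xs` is the hypothesis for the insertion, and
  -- `I.entries` turns the whole into `u′`.
  u″ : Unique (xs ++ x ∷ concat P)
  u″ = Unique-resp-↭ (↭-sym (shift x xs (concat P))) u
  I  = insert-correct x P P< (Unique-++⁻ʳ xs u″)
  module I = Insertion I
  u′ : Unique (xs ++ concat P′)
  u′ = Unique-resp-↭ (++⁺ˡ xs (↭-sym I.entries)) u″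
  shape′ : map length P′ ≡ map length Q′
  shape′ = trans I.shape (trans (cong (growRow k) shape≡) (sym (addSquare-shape k i Q)))
  Q′<is : All (λ j → All (_< j) (concat Q′)) (map proj₂ ps)
  Q′<is = All.zipWith
    (λ (i<j , Q<j) → All-resp-↭ (↭-sym (addSquare-entries k i Q)) (i<j ∷ Q<j)) (i< , Q<is)

-- Inversions of a permutation and of its word

length-filter-tabulate-suc : ∀ {n} {P : Pred (Fin (suc n)) 0ℓ} (P? : Decidable P) →
  length (filter P? (tabulate Fin.suc)) ≡ length (filter (P? ∘ Fin.suc) (allFin n))
length-filter-tabulate-suc P? = trans
  (cong (length ∘ filter P?) (sym (map-tabulate id Fin.suc))) (length-filter-map P? Fin.suc (allFin _))

-- Split the pairs by whether the first position is zero. The function is arbitrary because the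
-- induction passes to `f ∘ Fin.suc`, which no longer comes from a permutation.
wordInversions-tabulate : ∀ {n} (f : Fin n → ℕ) →
  length (filter (λ (i , j) → (i <ᶠ? j) ×-dec (f j <? f i)) (cartesianProduct (allFin n) (allFin n)))
  ≡ wordInversions (tabulate f)
wordInversions-tabulate {zero}  f = refl
wordInversions-tabulate {suc n} f = begin
  length (filter P? (cartesianProduct (allFin (suc n)) (allFin (suc n))))
    ≡⟨ length-filter-cartesianProduct P? (allFin (suc n)) (allFin (suc n)) ⟩
  later Fin.zero + sum (map later (tabulate Fin.suc))
    ≡⟨ cong₂ _+_ first rest ⟩
  inversionsBetween [ f Fin.zero ] (tabulate f′) + wordInversions (tabulate f′) ∎
  where
  f′ = f ∘ Fin.suc
  P? = λ (i , j) → (i <ᶠ? j) ×-dec (f j <? f i)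
  P′? = λ (i , j) → (i <ᶠ? j) ×-dec (f′ j <? f′ i)
  later : Fin (suc n) → ℕ
  later i = length (filter (λ j → P? (i , j)) (allFin (suc n)))
  first : later Fin.zero ≡ inversionsBetween [ f Fin.zero ] (tabulate f′)
  first = begin
    -- The pair of `Fin.zero` with itself has already been discarded by computation, and `later-suc`
    -- likewise loses its pairs with second position `Fin.zero`.
    length (filter (λ j → P? (Fin.zero , j)) (tabulate Fin.suc))
      ≡⟨ length-filter-tabulate-suc (λ j → P? (Fin.zero , j)) ⟩
    length (filter (λ j → P? (Fin.zero , Fin.suc j)) (allFin n))
      ≡⟨ cong length (filter-≐ _ (λ j → f′ j <? f Fin.zero) (proj₂ , (z<s ,_)) (allFin n)) ⟩
    length (filter (λ j → f′ j <? f Fin.zero) (allFin n))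
      ≡⟨ length-filter-map (_<? f Fin.zero) f′ (allFin n) ⟨
    countBelow (f Fin.zero) (map f′ (allFin n))
      ≡⟨ cong (countBelow (f Fin.zero)) (map-tabulate id f′) ⟩
    countBelow (f Fin.zero) (tabulate f′)
      ≡⟨ inversionsBetween-[-]ˡ (f Fin.zero) (tabulate f′) ⟨
    inversionsBetween [ f Fin.zero ] (tabulate f′) ∎
  later-suc : ∀ i → later (Fin.suc i) ≡ length (filter (λ j → P′? (i , j)) (allFin n))
  later-suc i = trans (length-filter-tabulate-suc (λ j → P? (Fin.suc i , j)))
    (cong length (filter-≐ _ _
      ((λ (i<j , q) → ℕ.s<s⁻¹ i<j , q) , (λ (i<j , q) → s<s i<j , q)) (allFin n)))
  rest : sum (map later (tabulate Fin.suc)) ≡ wordInversions (tabulate f′)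
  rest = begin
    sum (map later (tabulate Fin.suc))
      ≡⟨ cong sum (trans (map-tabulate Fin.suc later) (sym (map-tabulate id (later ∘ Fin.suc)))) ⟩
    sum (map (later ∘ Fin.suc) (allFin n))
      ≡⟨ cong sum (map-cong later-suc (allFin n)) ⟩
    sum (map (λ i → length (filter (λ j → P′? (i , j)) (allFin n))) (allFin n))
      ≡⟨ length-filter-cartesianProduct P′? (allFin n) (allFin n) ⟨
    length (filter P′? (cartesianProduct (allFin n) (allFin n)))
      ≡⟨ wordInversions-tabulate f′ ⟩
    wordInversions (tabulate f′) ∎

-- The letters of the word are values shifted by one, which preserves all comparisons.
permInv-wordInversions : ∀ {n} (π : Permutation′ n) →
                         permInv π ≡ wordInversions (tabulate (λ i → suc (toℕ (π ⟨$⟩ʳ i))))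
permInv-wordInversions {n} π = trans
  (cong length (filter-≐ _ _
    ((λ (i<j , q) → i<j , s<s q) , (λ (i<j , q) → i<j , ℕ.s<s⁻¹ q))
    (cartesianProduct (allFin n) (allFin n))))
  (wordInversions-tabulate (λ i → suc (toℕ (π ⟨$⟩ʳ i))))

permInv-parity : ∀ {n} (π : Permutation′ n) → parity (permInv π) ≡ parity (defect (RSK π))
permInv-parity π = begin
  parity (permInv π)
    ≡⟨ cong parity (trans (permInv-wordInversions π) (cong wordInversions word≡)) ⟩
  parity (wordInversions (map proj₁ ps))
    -- For the empty pair, `defect` and the inversions with letters already inserted both compute to
    -- 0, so only the inversions of the full word remain.
    ≡⟨ foldl-insertAndRecord [] [] ps [] refl unique
         (subst Increasing (sym positions≡) (AllPairsₚ.tabulate⁺-< s<s))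
         (All.universal (λ _ → []) _) ⟨
  parity (defect (RSK π)) ∎
  where
  word = λ i → suc (toℕ (π ⟨$⟩ʳ i))
  ps = tabulate (λ i → word i , suc (toℕ i))
  word≡ : tabulate word ≡ map proj₁ ps
  word≡ = sym (map-tabulate _ proj₁)
  positions≡ : map proj₂ ps ≡ tabulate (suc ∘ toℕ)
  positions≡ = map-tabulate _ proj₂
  unique : Unique (map proj₁ ps ++ [])
  unique = subst Unique (trans word≡ (sym (++-identityʳ _)))
    (Uniqueₚ.tabulate⁺ (Injection.injective (↔⇒↣ π) ∘ toℕ-injective ∘ suc-injective))

theorem4p3 : ∀ (n : ℕ) → n ≥ 1 → (π : Permutation′ n) → let (P , Q) = RSK π in permSign π ≡ sign P * sign Q * (-1ℤ ^ evenRowsLength P)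
theorem4p3 n _ π = begin
  -1ℤ ^ permInv π
    ≡⟨ -1^-parity (permInv π) (defect (RSK π)) (permInv-parity π) ⟩
  -1ℤ ^ (inv P + e + inv Q)
    ≡⟨ cong (-1ℤ ^_) (solve 3 (λ a e b → a :+ e :+ b := a :+ b :+ e) refl (inv P) e (inv Q)) ⟩
  -1ℤ ^ (inv P + inv Q + e)
    ≡⟨ ^-distribˡ-+-* -1ℤ (inv P + inv Q) e ⟩
  -1ℤ ^ (inv P + inv Q) * -1ℤ ^ e
    ≡⟨ cong (_* -1ℤ ^ e) (^-distribˡ-+-* -1ℤ (inv P) (inv Q)) ⟩
  sign P * sign Q * (-1ℤ ^ e) ∎
  where
  P = proj₁ (RSK π)
  Q = proj₂ (RSK π)
  e = evenRowsLength P
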